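{- Let $\Pi$ be a graph property and $d$ a constant such that (i) every $n$-vertex graph in $\Pi$ has minimum degree at least $n-d$, and (ii) membership of an $n$-vertex graph in $\Pi$ can be verified in $n^{O(1)}$ time. Then $\Pi$-Vertex Deletion can be solved in $2^{\sqrt{2m}}\cdot n^{d+O(1)}$ time, where $n$ and $m$ are the numbers of vertices and edges of the input graph.
   Context: A graph property $\Pi$ is a set of finite simple undirected graphs. $\Pi$-Vertex Deletion: given a graph $G=(V,E)$ and integer $k$, decide whether there is $S\subseteq V$ with $|S|\le k$ and $G[V\setminus S]\in\Pi$. -}

module Defs where

open import Data.Bool using (Bool; true; false; T?)
open import Data.Fin using (Fin; zero; suc; _<?_)
open import Data.Fin.Subset using (Subset; inside; outside; ∣_∣; ∁)
open import Data.Integer using (ℤ; +_; -[1+_])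
import Data.Integer as ℤ
open import Data.List using (List; []; _∷_; length; filter; cartesianProduct; allFin; map; replicate)
open import Data.Nat using (ℕ; suc; _+_; _*_; _^_; _≤_; NonZero)
open import Data.Product using (Σ; ∃; _×_; _,_)
open import Data.Vec using (Vec; []; _∷_; lookup; tabulate; _[_]≔_)
import Data.Vec as Vec
open import Level using (Level)
import Level
open import Relation.Binary.PropositionalEquality using (_≡_)
open import Relation.Nullary using (Reflects; _×-dec_)
open import Relation.Unary using (Pred; _∈_)

------------------------------------------------------------------------
-- Finite simple graphs

record Graph : Set where
  field
    order : ℕ

  Vertex : Set
  Vertex = Fin order

  field
    adj   : Vertex → Vertex → Bool
    sym   : ∀ u v → adj u v ≡ adj v u
    irrefl : ∀ v → adj v v ≡ false

open Graph public using (order; adj; Vertex)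

neighbours : (G : Graph) → Vertex G → Subset (order G)
neighbours G v = tabulate (adj G v)

degree : (G : Graph) → Vertex G → ℕ
degree G v = ∣ neighbours G v ∣

MinDegreeAtLeast : Graph → ℕ → Set
MinDegreeAtLeast G δ = ∀ v → δ ≤ degree G v

-- Each edge is listed once, with its smaller endpoint first.
edges : (G : Graph) → List (Vertex G × Vertex G)
edges G = filter (λ (u , v) → (u <? v) ×-dec T? (adj G u v))
                 (cartesianProduct (allFin (order G)) (allFin (order G)))

size : Graph → ℕ
size G = length (edges G)

-- The i-th smallest element of W.
element : ∀ {n} (W : Subset n) → Fin ∣ W ∣ → Fin n
element (inside  ∷ W) zero    = zero
element (inside  ∷ W) (suc i) = suc (element W i)
element (outside ∷ W) i       = suc (element W i)

-- The induced subgraph G[W].  Its vertices are renumbered in increasing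
-- order, since every graph has vertex set Fin n.
induced : (G : Graph) → Subset (order G) → Graph
induced G W = record
  { order  = ∣ W ∣
  ; adj    = λ i j → adj G (element W i) (element W j)
  ; sym    = λ i j → Graph.sym G (element W i) (element W j)
  ; irrefl = λ i → Graph.irrefl G (element W i)
  }

-- Closure under isomorphism is not required.
GraphProperty : (ℓ : Level) → Set (Level.suc ℓ)
GraphProperty ℓ = Pred Graph ℓ

VertexDeletion : ∀ {ℓ} → GraphProperty ℓ → Pred (Graph × ℤ) ℓ
VertexDeletion Π (G , k) =
  Σ (Subset (order G)) λ S → (+ ∣ S ∣ ℤ.≤ k) × (induced G (∁ S) ∈ Π)

------------------------------------------------------------------------
-- Model of computation: Jones's WHILE language ("Computability and
-- Complexity from a Programming Perspective", 1997).  Values are binary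
-- trees.  Each operator and each loop or branch test takes one unit of
-- time; this is realistic since trees are immutable, so a RAM represents
-- them by shared pointers and executes every step in constant time.
-- Conversely a RAM computation of length t, with words of O(log t) bits,
-- is simulated with overhead polynomial in log t.

infixr 5 _·_

data Tree : Set where
  nil : Tree
  _·_ : Tree → Tree → Tree

left right : Tree → Tree
left nil       = nil
left (x · y)   = x
right nil      = nil
right (x · y)  = y

data Exp (r : ℕ) : Set where
  var   : Fin r → Exp r
  nil   : Exp r
  cons  : Exp r → Exp r → Exp r
  hd tl : Exp r → Exp r

Store : ℕ → Set
Store r = Vec Tree r

eval : ∀ {r} → Exp r → Store r → Tree
eval (var x)    σ = lookup σ x
eval nil        σ = nil
eval (cons e f) σ = eval e σ · eval f σ
eval (hd e)     σ = left (eval e σ)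
eval (tl e)     σ = right (eval e σ)

cost : ∀ {r} → Exp r → ℕ
cost (var x)    = 1
cost nil        = 1
cost (cons e f) = 1 + (cost e + cost f)
cost (hd e)     = 1 + cost e
cost (tl e)     = 1 + cost e

infix  6 _:=_
infixr 4 _⨾_

data Cmd (r : ℕ) : Set where
  _:=_          : Fin r → Exp r → Cmd r
  _⨾_           : Cmd r → Cmd r → Cmd r
  if_then_else_ : Exp r → Cmd r → Cmd r → Cmd r
  while_loop_   : Exp r → Cmd r → Cmd r

-- ⟨ c , σ ⟩⇓ σ′ in-time t : started in store σ, the command c halts after
-- exactly t units of time in store σ′.  The tree nil counts as false,
-- every other tree as true.
infix 3 ⟨_,_⟩⇓_in-time_

data ⟨_,_⟩⇓_in-time_ {r : ℕ} : Cmd r → Store r → Store r → ℕ → Set where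

  assign : ∀ {x e σ} →
    ⟨ x := e , σ ⟩⇓ σ [ x ]≔ eval e σ in-time 1 + cost e

  seq : ∀ {c₁ c₂ σ σ′ σ″ t₁ t₂} →
    ⟨ c₁ , σ ⟩⇓ σ′ in-time t₁ →
    ⟨ c₂ , σ′ ⟩⇓ σ″ in-time t₂ →
    ⟨ c₁ ⨾ c₂ , σ ⟩⇓ σ″ in-time t₁ + t₂

  if-true : ∀ {e c₁ c₂ σ σ′ x y t} →
    eval e σ ≡ x · y →
    ⟨ c₁ , σ ⟩⇓ σ′ in-time t →
    ⟨ if e then c₁ else c₂ , σ ⟩⇓ σ′ in-time 1 + (cost e + t)

  if-false : ∀ {e c₁ c₂ σ σ′ t} →
    eval e σ ≡ nil →
    ⟨ c₂ , σ ⟩⇓ σ′ in-time t →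
    ⟨ if e then c₁ else c₂ , σ ⟩⇓ σ′ in-time 1 + (cost e + t)

  while-true : ∀ {e c σ σ′ σ″ x y t₁ t₂} →
    eval e σ ≡ x · y →
    ⟨ c , σ ⟩⇓ σ′ in-time t₁ →
    ⟨ while e loop c , σ′ ⟩⇓ σ″ in-time t₂ →
    ⟨ while e loop c , σ ⟩⇓ σ″ in-time 1 + (cost e + (t₁ + t₂))

  while-false : ∀ {e c σ} →
    eval e σ ≡ nil →
    ⟨ while e loop c , σ ⟩⇓ σ in-time 1 + cost e

-- Variable zero holds the input and, at the end, the output.
record Program : Set where
  field
    extra : ℕ
    body  : Cmd (suc extra)

Outputs_On_InTime_ : Program → Tree → Tree → ℕ → Set
Outputs_On_InTime_ p out inp t =
  ∃ λ rest → ⟨ body , inp ∷ Vec.replicate extra nil ⟩⇓ out ∷ rest in-time t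
  where open Program p

------------------------------------------------------------------------
-- Encodings of instances

encodeBool : Bool → Tree
encodeBool false = nil
encodeBool true  = nil · nil

encodeList : List Tree → Tree
encodeList []       = nil
encodeList (x ∷ xs) = x · encodeList xs

-- The adjacency matrix, row by row.
encodeGraph : Graph → Tree
encodeGraph G =
  encodeList (map (λ u → encodeList (map (λ v → encodeBool (adj G u v)) vertices)) vertices)
  where vertices = allFin (order G)

encodeℕ : ℕ → Tree
encodeℕ n = encodeList (replicate n nil)

encodeℤ : ℤ → Tree
encodeℤ (+ n)    = encodeBool false · encodeℕ n
encodeℤ -[1+ n ] = encodeBool true  · encodeℕ n

-- Unary numbers do no harm: running times are measured in terms of the
-- graph alone.
encodeInstance : Graph × ℤ → Tree
encodeInstance (G , k) = encodeGraph G · encodeℤ k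

------------------------------------------------------------------------
-- Decision problems and running times

-- A single program decides P, and Within x t holds of its running time t
-- on each instance x.
DecidableInTime : ∀ {ℓ} {I : Set} → (I → Tree) → Pred I ℓ → (I → ℕ → Set) → Set ℓ
DecidableInTime {I = I} encode P Within =
  Σ Program λ p → ∀ (x : I) →
    Σ Bool λ b → Σ ℕ λ t →
      (Outputs_On_InTime_ p (encodeBool b) (encode x) t) ×
      Reflects (P x) b ×
      Within x t

-- t ≤2^√ x · b says that t ≤ 2^(√x) * b as real numbers: 2^(√x) is the
-- infimum of 2^(p/q) over the nonnegative rationals p/q ≥ √x, and
-- t ≤ 2^(p/q) * b means t^q ≤ 2^p * b^q.
infix 4 _≤2^√_·_

_≤2^√_·_ : ℕ → ℕ → ℕ → Set
t ≤2^√ x · b =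
  ∀ (p q : ℕ) → NonZero q → x * (q * q) ≤ p * p → t ^ q ≤ 2 ^ p * b ^ q

{-# OPTIONS --safe #-}
module Submission where

-- Let H = G[W] ∈ Π.  If W is nonempty, let v be a vertex of W of least degree
-- in G, and let R = N(v).  Then W consists of vertices of degree ≥ |R|, and at
-- most d of them lie outside R.  If h vertices of R have degree ≥ |R|, then
-- h² ≤ h |R| ≤ Σ deg = 2m, so for fixed R there are at most 2^√(2m) (1+n)^d such
-- sets W.  Trying R = ∅ (which covers W = ∅) and the n neighbourhoods
-- R = N(v) therefore suffices.  For each R the sets are grown breadth first,
-- vertex by vertex, each carrying the number of vertices outside R that it may
-- still take.

-- The running time has to be linear in the number of candidates, since a square of that number
-- would square 2^√(2m), and the exponent of n may exceed `d` only by a constant that depends on the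
-- oracle's exponent. So no loop over candidates runs inside another, and the enumeration has no
-- dead ends: leaving out all remaining vertices completes any partial set, hence no intermediate
-- list is longer than the last one. The pivot minimises the degree in G rather than in G[W],
-- because the sum bounded by 2m is that of the degrees in G. The inequality h ≤ |R| holds because
-- only vertices inside R are counted by h; the others are paid for by the budget `d`.

open import Defs
import Algebra.Properties.CommutativeMonoid.Sum
open import Data.Bool using (Bool; true; false; not; _∧_; _∨_; T; T?)
open import Data.Bool.Properties using (T-≡)
open import Data.Empty.Polymorphic using (⊥)
open import Data.Fin using (Fin; zero; suc; punchIn) renaming (_<_ to _<ᶠ_; _<?_ to _<ᶠ?_)
import Data.Fin.Properties as Fin
open import Data.Fin.Subset using (Subset; inside; outside; ∣_∣; ∁; _∩_; _⊆_) renaming (_∈_ to _∈ₛ_; ⊥ to ∅)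
import Data.Fin.Subset.Properties as Subset
open import Data.Integer using (ℤ; -[1+_])
import Data.Integer as ℤ
open import Data.List using (List; []; _∷_; length; map; filter; concatMap; cartesianProduct; allFin; foldl; foldr; _++_; _ʳ++_; reverse) renaming (tabulate to tabulateL)
open import Data.List.Membership.Propositional using (lose) renaming (_∈_ to _∈ₗ_)
open import Data.List.Membership.Propositional.Properties using (∈-concatMap⁺; ∈-tabulate⁺)
open import Data.List.Properties using (map-tabulate; filter-++; length-++; length-map; length-reverse; length-tabulate; tabulate-cong; ++-ʳ++; reverse-foldl; reverse-involutive)
open import Data.List.Relation.Unary.Any as Any using (Any; here; there)
open import Data.List.Relation.Unary.Any.Properties using (reverse⁺)
open import Data.Nat
open import Data.Nat.ListAction using () renaming (sum to sumL)
open import Data.Nat.Properties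
open import Data.Nat.Tactic.RingSolver using (solve-∀)
open import Data.Product using (Σ; ∃; _×_; _,_; proj₁; proj₂)
open import Data.Sum as Sum using (_⊎_; inj₁; inj₂)
open import Data.Unit using (⊤)
open import Data.Vec using (Vec; []; _∷_; lookup; replicate; tabulate; toList; zip; _[_]≔_; here; there)
open import Data.Vec.Properties using (length-toList; lookup⇒[]=; lookup∘tabulate)
open import Function using (_∘_; flip; id; Equivalence)
open import Relation.Binary using (tri<; tri≈; tri>)
open import Relation.Binary.PropositionalEquality hiding ([_])
open import Relation.Nullary using (Dec; Reflects; ofʸ; ofⁿ; yes; no; does; contradiction; _×-dec_)
open import Relation.Nullary.Decidable using (dec-true)
open import Relation.Nullary.Reflects using (_×-reflects_; _⊎-reflects_; ⊥-reflects)
open import Relation.Unary using (Pred; Decidable; _∈_)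

-- Commands with upper bounds on the running time

infix 3 ⟨_,_⟩⇓_within_

⟨_,_⟩⇓_within_ : ∀ {r} → Cmd r → Store r → Store r → ℕ → Set
⟨ c , σ ⟩⇓ σ′ within t = ∃ λ u → u ≤ t × ⟨ c , σ ⟩⇓ σ′ in-time u

module _ {r : ℕ} where

  exactly : ∀ {c : Cmd r} {σ σ′ t} → ⟨ c , σ ⟩⇓ σ′ in-time t → ⟨ c , σ ⟩⇓ σ′ within t
  exactly run = _ , ≤-refl , run

  weaken : ∀ {c : Cmd r} {σ σ′ t u} → t ≤ u → ⟨ c , σ ⟩⇓ σ′ within t → ⟨ c , σ ⟩⇓ σ′ within u
  weaken t≤u (v , v≤t , run) = v , ≤-trans v≤t t≤u , run

  infixr 4 _then_

  _then_ : ∀ {c₁ c₂ : Cmd r} {σ σ′ σ″ t u} →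
    ⟨ c₁ , σ ⟩⇓ σ′ within t → ⟨ c₂ , σ′ ⟩⇓ σ″ within u → ⟨ c₁ ⨾ c₂ , σ ⟩⇓ σ″ within t + u
  (v , v≤t , run) then (w , w≤u , run′) = v + w , +-mono-≤ v≤t w≤u , seq run run′

-- Renaming registers, and resetting them.

module _ {r r′ : ℕ} (ρ : Fin r → Fin r′) where

  renameExp : Exp r → Exp r′
  renameExp (var x)    = var (ρ x)
  renameExp nil        = nil
  renameExp (cons e f) = cons (renameExp e) (renameExp f)
  renameExp (hd e)     = hd (renameExp e)
  renameExp (tl e)     = tl (renameExp e)

  rename : Cmd r → Cmd r′
  rename (x := e)             = ρ x := renameExp e
  rename (c₁ ⨾ c₂)            = rename c₁ ⨾ rename c₂
  rename (if e then c else d) = if renameExp e then rename c else rename d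
  rename (while e loop c)     = while renameExp e loop rename c

  cost-rename : ∀ e → cost (renameExp e) ≡ cost e
  cost-rename (var x)    = refl
  cost-rename nil        = refl
  cost-rename (cons e f) = cong suc (cong₂ _+_ (cost-rename e) (cost-rename f))
  cost-rename (hd e)     = cong suc (cost-rename e)
  cost-rename (tl e)     = cong suc (cost-rename e)

  eval-rename : ∀ {σ τ} → (∀ x → lookup τ (ρ x) ≡ lookup σ x) →
    ∀ e → eval (renameExp e) τ ≡ eval e σ
  eval-rename look (var x)    = look x
  eval-rename look nil        = refl
  eval-rename look (cons e f) = cong₂ _·_ (eval-rename look e) (eval-rename look f)
  eval-rename look (hd e)     = cong left (eval-rename look e)
  eval-rename look (tl e)     = cong right (eval-rename look e)

  module _ (ι : Store r → Store r′)
    (look : ∀ σ x → lookup (ι σ) (ρ x) ≡ lookup σ x)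
    (update : ∀ σ x v → ι σ [ ρ x ]≔ v ≡ ι (σ [ x ]≔ v)) where

    -- This makes the oracle callable as a subroutine. `ι` places a store in a larger one; reads and
    -- writes through `ρ` commute with it, so whatever `ι` adds survives the run, and the time is
    -- unchanged.
    rename-⇓ : ∀ {c σ σ′ t} → ⟨ c , σ ⟩⇓ σ′ in-time t → ⟨ rename c , ι σ ⟩⇓ ι σ′ in-time t
    rename-⇓ {σ = σ} (assign {x} {e}) =
      subst₂ (λ σ′ t → ⟨ ρ x := renameExp e , ι σ ⟩⇓ σ′ in-time t)
        (trans (cong (ι σ [ ρ x ]≔_) (eval-rename (look σ) e)) (update σ x _))
        (cong suc (cost-rename e)) assign
    rename-⇓ (seq run run′) = seq (rename-⇓ run) (rename-⇓ run′)
    rename-⇓ (if-true {e} eq run) rewrite sym (cost-rename e) =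
      if-true (trans (eval-rename (look _) e) eq) (rename-⇓ run)
    rename-⇓ (if-false {e} eq run) rewrite sym (cost-rename e) =
      if-false (trans (eval-rename (look _) e) eq) (rename-⇓ run)
    rename-⇓ (while-true {e} eq run run′) rewrite sym (cost-rename e) =
      while-true (trans (eval-rename (look _) e) eq) (rename-⇓ run) (rename-⇓ run′)
    rename-⇓ (while-false {e} eq) rewrite sym (cost-rename e) =
      while-false (trans (eval-rename (look _) e) eq)

-- A decider is specified only for a start with `nil` in its auxiliary registers, whereas an earlier
-- call leaves arbitrary values there. Hence the reset before each call.
clear : ∀ {r} → Store r → List (Fin r) → Store r
clear = foldl (λ σ x → σ [ x ]≔ nil)

clearing_then_ : ∀ {r} → List (Fin r) → Cmd r → Cmd r
clearing xs then c = foldr (λ x d → x := nil ⨾ d) c xs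

clear-suc : ∀ {r v} (js : Store r) xs → clear (v ∷ js) (map suc xs) ≡ v ∷ clear js xs
clear-suc js []       = refl
clear-suc js (x ∷ xs) = clear-suc (js [ x ]≔ nil) xs

clear-all : ∀ {r} (js : Store r) → clear js (allFin r) ≡ replicate r nil
clear-all []                = refl
clear-all {suc r} (v ∷ js) =
  trans (cong (clear (nil ∷ js)) (sym (map-tabulate id suc)))
    (trans (clear-suc js (allFin r)) (cong (nil ∷_) (clear-all js)))

clearing-⇓ : ∀ {r c} {σ σ′ : Store r} {t} xs → ⟨ c , clear σ xs ⟩⇓ σ′ within t →
  ⟨ clearing xs then c , σ ⟩⇓ σ′ within length xs * 2 + t
clearing-⇓ []       run = run
clearing-⇓ (x ∷ xs) run = exactly assign then clearing-⇓ xs run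

-- Time bounds are polynomials in two quantities: short lists have length O(n),
-- long lists consist of candidate vertex sets.

data Range : Set where
  short long : Range

infixl 6 _⊕_
infixl 7 _⊗_

-- A syntax, so that degrees are computed by evaluation even where coefficients contain unknowns.
-- `short^_` is primitive because the oracle's exponent is itself a variable.
data Poly : Set where
  con     : ℕ → Poly
  range   : Range → Poly
  short^_ : ℕ → Poly
  _⊕_ _⊗_ : Poly → Poly → Poly

limit : ℕ → ℕ → Range → ℕ
limit M B short = M
limit M B long  = B

at : Poly → ℕ → ℕ → ℕ
at (con k)    M B = k
at (range r)  M B = limit M B r
at (short^ a) M B = M ^ a
at (P ⊕ Q)    M B = at P M B + at Q M B
at (P ⊗ Q)    M B = at P M B * at Q M B

weight degreeShort degreeLong : Poly → ℕ

weight (con k)    = k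
weight (range r)  = 1
weight (short^ a) = 1
weight (P ⊕ Q)    = weight P + weight Q
weight (P ⊗ Q)    = weight P * weight Q

degreeShort (con k)       = 0
degreeShort (range short) = 1
degreeShort (range long)  = 0
degreeShort (short^ a)    = a
degreeShort (P ⊕ Q)       = degreeShort P ⊔ degreeShort Q
degreeShort (P ⊗ Q)       = degreeShort P + degreeShort Q

degreeLong (con k)       = 0
degreeLong (range short) = 0
degreeLong (range long)  = 1
degreeLong (short^ a)    = 0
degreeLong (P ⊕ Q)       = degreeLong P ⊔ degreeLong Q
degreeLong (P ⊗ Q)       = degreeLong P + degreeLong Q

-- As `M` and `B` are at least 1, both summands of `P ⊕ Q` may be raised to the larger exponents.
at≤monomial : ∀ P M B .{{_ : NonZero M}} .{{_ : NonZero B}} →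
  at P M B ≤ weight P * (M ^ degreeShort P * B ^ degreeLong P)
at≤monomial (con k)       M B = ≤-reflexive (sym (*-identityʳ k))
at≤monomial (range short) M B = ≤-reflexive (pad M)
  where
  pad : ∀ m → m ≡ 1 * (m * 1 * 1)
  pad = solve-∀
at≤monomial (range long) M B = ≤-reflexive (pad B)
  where
  pad : ∀ m → m ≡ 1 * (1 * (m * 1))
  pad = solve-∀
at≤monomial (short^ a) M B = ≤-reflexive (pad (M ^ a))
  where
  pad : ∀ m → m ≡ 1 * (m * 1)
  pad = solve-∀
at≤monomial (P ⊕ Q) M B = begin
  at P M B + at Q M B
    ≤⟨ +-mono-≤ (at≤monomial P M B) (at≤monomial Q M B) ⟩
  weight P * (M ^ degreeShort P * B ^ degreeLong P) + weight Q * (M ^ degreeShort Q * B ^ degreeLong Q)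
    ≤⟨ +-mono-≤
         (*-monoʳ-≤ (weight P) (*-mono-≤ (^-monoʳ-≤ M (m≤m⊔n (degreeShort P) _)) (^-monoʳ-≤ B (m≤m⊔n (degreeLong P) _))))
         (*-monoʳ-≤ (weight Q) (*-mono-≤ (^-monoʳ-≤ M (m≤n⊔m (degreeShort P) _)) (^-monoʳ-≤ B (m≤n⊔m (degreeLong P) _)))) ⟩
  weight P * D + weight Q * D
    ≡⟨ *-distribʳ-+ D (weight P) (weight Q) ⟨
  (weight P + weight Q) * D ∎
  where
  open ≤-Reasoning
  D = M ^ degreeShort (P ⊕ Q) * B ^ degreeLong (P ⊕ Q)
at≤monomial (P ⊗ Q) M B = begin
  at P M B * at Q M B
    ≤⟨ *-mono-≤ (at≤monomial P M B) (at≤monomial Q M B) ⟩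
  weight P * (M ^ degreeShort P * B ^ degreeLong P) * (weight Q * (M ^ degreeShort Q * B ^ degreeLong Q))
    ≡⟨ interchange (weight P) (weight Q) (M ^ degreeShort P) (B ^ degreeLong P) (M ^ degreeShort Q) (B ^ degreeLong Q) ⟩
  weight P * weight Q * (M ^ degreeShort P * M ^ degreeShort Q * (B ^ degreeLong P * B ^ degreeLong Q))
    ≡⟨ cong (weight P * weight Q *_)
         (cong₂ _*_ (^-distribˡ-+-* M (degreeShort P) _) (^-distribˡ-+-* B (degreeLong P) _)) ⟨
  weight P * weight Q * (M ^ degreeShort (P ⊗ Q) * B ^ degreeLong (P ⊗ Q)) ∎
  where
  open ≤-Reasoning
  interchange : ∀ p q m b m′ b′ → p * (m * b) * (q * (m′ * b′)) ≡ p * q * (m * m′ * (b * b′))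
  interchange = solve-∀

-- A functional language over WHILE

infixr 4 _»_

-- bind e f maps x to (f (e x) · x), and loop r f folds f over the list in
-- the left component of its argument, the right component being the state.
data Fn : Set where
  ret    : Exp 1 → Fn
  _»_    : Fn → Fn → Fn
  bind   : Exp 1 → Fn → Fn
  cond   : Exp 1 → Fn → Fn → Fn
  loop   : Range → Fn → Fn
  oracle : Fn

arg : Exp 1
arg = var zero

value : Exp 1 → Tree → Tree
value e x = eval e (x ∷ [])

-- The oracle is a WHILE command with e auxiliary registers, run in time A Mᵃ;
-- 13 and 24 are the costs of the stack operations around a call and an iteration.
module Cost (e A a : ℕ) where

  poly : Fn → Poly
  poly (ret x)      = con (1 + cost x)
  poly (f » g)      = poly f ⊕ poly g
  poly (bind x f)   = con (13 + cost x) ⊕ poly f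
  poly (cond x f g) = con (1 + cost x) ⊕ (poly f ⊕ poly g)
  poly (loop r f)   = range r ⊗ (con 24 ⊕ poly f)
  poly oracle       = con (e * 2) ⊕ con A ⊗ short^ a

module Machine {e : ℕ} (Q : Cmd (suc e)) (A a : ℕ) where

  open Cost e A a public

  -- Argument and result of a function live in `acc`, saved values in the list `stk`. All other
  -- registers belong to the oracle.
  acc stk : Fin (2 + e)
  acc = zero
  stk = suc zero

  auxiliary : List (Fin (2 + e))
  auxiliary = map suc (map suc (allFin e))

  lift : Exp 1 → Exp (2 + e)
  lift = renameExp (λ _ → acc)

  compile : Fn → Cmd (2 + e)
  compile (ret x)      = acc := lift x
  compile (f » g)      = compile f ⨾ compile g
  compile (bind x f)   =
    stk := cons (var acc) (var stk) ⨾ acc := lift x ⨾ compile f ⨾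
    acc := cons (var acc) (hd (var stk)) ⨾ stk := tl (var stk)
  compile (cond x f g) = if lift x then compile f else compile g
  compile (loop r f)   =
    (while hd (var acc) loop
      (stk := cons (tl (hd (var acc))) (var stk) ⨾
       acc := cons (hd (hd (var acc))) (tl (var acc)) ⨾ compile f ⨾
       acc := cons (hd (var stk)) (var acc) ⨾ stk := tl (var stk))) ⨾
    acc := tl (var acc)
  compile oracle       =
    clearing auxiliary then rename (punchIn stk) Q

  module Run (M B : ℕ) where

    time : Fn → ℕ
    time f = at (poly f) M B

    infix 3 _⊢_⇒_

    -- The stack `s` is arbitrary and restored, which lets calls nest. The oracle's registers may
    -- change, as its calls leave garbage in them.
    record _⊢_⇒_ (f : Fn) (x y : Tree) : Set where
      constructor runs
      field
        run : ∀ s js → ∃ λ js′ → ⟨ compile f , x ∷ s ∷ js ⟩⇓ y ∷ s ∷ js′ within time f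
    open _⊢_⇒_ public

    private
      cost-lift : ∀ x → cost (lift x) ≡ cost x
      cost-lift = cost-rename _

      eval-lift : ∀ {x s js} ex → eval (lift ex) (x ∷ s ∷ js) ≡ value ex x
      eval-lift = eval-rename _ λ { zero → refl }

      lifted : ∀ {x s js} ex → ⟨ acc := lift ex , x ∷ s ∷ js ⟩⇓ value ex x ∷ s ∷ js within 1 + cost ex
      lifted {x} {s} {js} ex =
        subst₂ (λ y t → ⟨ acc := lift ex , x ∷ s ∷ js ⟩⇓ y ∷ s ∷ js within t)
          (eval-lift ex) (cong suc (cost-lift ex)) (exactly assign)

    ⇒-ret : ∀ {ex x} → ret ex ⊢ x ⇒ value ex x
    ⇒-ret {ex} = runs λ s js → js , lifted ex

    infixr 4 _⇒-»_

    _⇒-»_ : ∀ {f g x y z} → f ⊢ x ⇒ y → g ⊢ y ⇒ z → f » g ⊢ x ⇒ z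
    F ⇒-» G = runs λ s js →
      let js′ , first  = run F s js
          js″ , second = run G s js′
      in  js″ , (first then second)

    ⇒-bind : ∀ {ex f x y} → f ⊢ value ex x ⇒ y → bind ex f ⊢ x ⇒ y · x
    ⇒-bind {ex} {f} {x} F = runs λ s js →
      let js′ , called = run F (x · s) js
      in  js′ , weaken (≤-reflexive (arith (cost ex) (time f)))
                  (exactly assign then lifted ex then called then exactly assign then exactly assign)
      where
      arith : ∀ c t → 4 + ((1 + c) + (t + 8)) ≡ 13 + c + t
      arith = solve-∀

    ⇒-true : ∀ {ex f g x y u v} → value ex x ≡ u · v → f ⊢ x ⇒ y → cond ex f g ⊢ x ⇒ y
    ⇒-true {ex} eq F = runs λ s js →
      let js′ , t , t≤ , taken = run F s js
      in  js′ , _ , s≤s (+-mono-≤ (≤-reflexive (cost-lift ex)) (≤-trans t≤ (m≤m+n _ _)))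
              , if-true (trans (eval-lift ex) eq) taken

    ⇒-false : ∀ {ex f g x y} → value ex x ≡ nil → g ⊢ x ⇒ y → cond ex f g ⊢ x ⇒ y
    ⇒-false {ex} {f} eq G = runs λ s js →
      let js′ , t , t≤ , taken = run G s js
      in  js′ , _ , s≤s (+-mono-≤ (≤-reflexive (cost-lift ex)) (≤-trans t≤ (m≤n+m _ (time f))))
              , if-false (trans (eval-lift ex) eq) taken

    -- The strict bound on the length leaves the price of one iteration over, which covers the 6
    -- units of the failing test and the final assignment. `P` restricts the body to reachable
    -- states, since a bound such as that on candidate lists fails for arbitrary ones.
    ⇒-loop : ∀ {A S : Set} (P : List A → S → Set) (enc : A → Tree) (encS : S → Tree) (g : A → S → S) {r f} →
      (∀ {x xs s} → P (x ∷ xs) s → (f ⊢ enc x · encS s ⇒ encS (g x s)) × P xs (g x s)) →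
      ∀ xs {s} → length xs < limit M B r → P xs s →
      loop r f ⊢ encodeList (map enc xs) · encS s ⇒ encS (foldl (flip g) s xs)
    ⇒-loop P enc encS g {r} {f} body xs len p₀ = runs λ s js →
      let js′ , iterated = iterate s xs p₀ js
      in  js′ , weaken bound (iterated then exactly assign)
      where
      iterate : ∀ s xs {s₀} → P xs s₀ → ∀ js → ∃ λ js′ →
        ⟨ _ , (encodeList (map enc xs) · encS s₀) ∷ s ∷ js ⟩⇓ (nil · encS (foldl (flip g) s₀ xs)) ∷ s ∷ js′
        within length xs * (24 + time f) + 3
      iterate s []       p js = js , exactly (while-false refl)
      iterate s (x ∷ xs) p js =
        let F , p′ = body p
            js₁ , called = run F (encodeList (map enc xs) · s) js
            t₁ , t₁≤ , run₁ = exactly assign then exactly assign then called then exactly assign then exactly assign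
            js₂ , t₂ , t₂≤ , run₂ = iterate s xs p′ js₁
        in  js₂ , _
          , ≤-trans (+-monoʳ-≤ 3 (+-mono-≤ t₁≤ t₂≤)) (≤-reflexive (arith (time f) (length xs * (24 + time f))))
          , while-true refl run₁ run₂
        where
        arith : ∀ t u → 3 + ((6 + (7 + (t + 8))) + (u + 3)) ≡ 24 + t + u + 3
        arith = solve-∀

      bound : length xs * (24 + time f) + 3 + 3 ≤ limit M B r * (24 + time f)
      bound = begin
        length xs * (24 + time f) + 3 + 3       ≡⟨ +-assoc (length xs * (24 + time f)) 3 3 ⟩
        length xs * (24 + time f) + 6           ≤⟨ +-monoʳ-≤ (length xs * (24 + time f)) (m≤m+n 6 (18 + time f)) ⟩
        length xs * (24 + time f) + (24 + time f) ≡⟨ +-comm (length xs * (24 + time f)) (24 + time f) ⟩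
        suc (length xs) * (24 + time f)         ≤⟨ *-monoˡ-≤ (24 + time f) len ⟩
        limit M B r * (24 + time f)             ∎
        where open ≤-Reasoning

    ⇒-oracle : ∀ {x y t} → (∃ λ rest → ⟨ Q , x ∷ replicate e nil ⟩⇓ y ∷ rest in-time t) →
      t ≤ A * M ^ a → oracle ⊢ x ⇒ y
    ⇒-oracle {x} {y} {t} (rest , call) t≤ = runs λ s js →
      rest , weaken (+-mono-≤ (≤-reflexive (cong (_* 2) length-auxiliary)) t≤)
        (clearing-⇓ auxiliary
          (subst (λ σ → ⟨ rename (punchIn stk) Q , σ ⟩⇓ y ∷ s ∷ rest within t) (sym (cleared s js))
            (exactly (rename-⇓ (punchIn stk) (frame s) (look s) (update s) call))))
      where
      length-auxiliary : length auxiliary ≡ e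
      length-auxiliary = trans (length-map suc (map suc (allFin e)))
        (trans (length-map suc (allFin e)) (length-tabulate id))
      frame : Tree → Store (suc e) → Store (2 + e)
      frame s (v ∷ vs) = v ∷ s ∷ vs
      look : ∀ s σ i → lookup (frame s σ) (punchIn stk i) ≡ lookup σ i
      look s (v ∷ vs) zero    = refl
      look s (v ∷ vs) (suc i) = refl
      update : ∀ s σ i v → frame s σ [ punchIn stk i ]≔ v ≡ frame s (σ [ i ]≔ v)
      update s (v ∷ vs) zero    w = refl
      update s (v ∷ vs) (suc i) w = refl
      cleared : ∀ s js → clear (x ∷ s ∷ js) auxiliary ≡ x ∷ s ∷ replicate e nil
      cleared s js = trans (clear-suc (s ∷ js) (map suc (allFin e)))
        (cong (x ∷_) (trans (clear-suc js (allFin e)) (cong (s ∷_) (clear-all js))))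

-- Candidates

-- In a candidate (W , b), b is the number of vertices outside R that may still
-- be added to W.  The flags of a vertex say whether it may be added at all and
-- whether it lies in R.
branch : ∀ {k} → Bool → Bool → Subset k × ℕ → List (Subset (suc k) × ℕ)
branch false _     (W , b)     = (outside ∷ W , b) ∷ []
branch true  true  (W , b)     = (outside ∷ W , b) ∷ (inside ∷ W , b) ∷ []
branch true  false (W , zero)  = (outside ∷ W , zero) ∷ []
branch true  false (W , suc b) = (outside ∷ W , suc b) ∷ (inside ∷ W , b) ∷ []

-- The program conses each new candidate onto its output. The reversal reproduces the order that
-- results.
extend : ∀ {k} → Bool → Bool → List (Subset k × ℕ) → List (Subset (suc k) × ℕ)
extend ok r L = reverse (concatMap (branch ok r) L)

candidates : ℕ → ∀ {k} → Subset k → Subset k → List (Subset k × ℕ)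
candidates d []       []      = ([] , d) ∷ []
candidates d (ok ∷ X) (r ∷ R) = extend ok r (candidates d X R)

private
  ∈-extend : ∀ {k} ok r {L : List (Subset k × ℕ)} {x y} →
    x ∈ₗ L → y ∈ₗ branch ok r x → y ∈ₗ extend ok r L
  ∈-extend ok r x∈L y∈ = reverse⁺ (∈-concatMap⁺ (branch ok r) (Any.map (λ { refl → y∈ }) x∈L))

-- The equation for `b` drives the induction: when `W` takes a vertex outside `R`, budget 0 would
-- mean that the rest of `W` already has `d` vertices outside `R`, against the assumed bound.
∈-candidates : ∀ d {k} (X R W : Subset k) → W ⊆ X → ∣ W ∩ ∁ R ∣ ≤ d →
  ∃ λ b → b + ∣ W ∩ ∁ R ∣ ≡ d × (W , b) ∈ₗ candidates d X R
∈-candidates d [] [] [] W⊆X c≤d = d , +-identityʳ d , here refl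
∈-candidates d (ok ∷ X) (r ∷ R) (outside ∷ W) W⊆X c≤d
  with b , eq , W∈ ← ∈-candidates d X R W (Subset.drop-∷-⊆ W⊆X) c≤d =
  b , eq , ∈-extend ok r W∈ (excluded ok r b)
  where
  excluded : ∀ ok r b → (outside ∷ W , b) ∈ₗ branch ok r (W , b)
  excluded false r     b       = here refl
  excluded true  true  b       = here refl
  excluded true  false zero    = here refl
  excluded true  false (suc b) = here refl
∈-candidates d (ok ∷ X) (r ∷ R) (inside ∷ W) W⊆X c≤d with W⊆X here
∈-candidates d (inside ∷ X) (true ∷ R) (inside ∷ W) W⊆X c≤d | here
  with b , eq , W∈ ← ∈-candidates d X R W (Subset.drop-∷-⊆ W⊆X) c≤d =
  b , eq , ∈-extend true true W∈ (there (here refl))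
∈-candidates d (inside ∷ X) (false ∷ R) (inside ∷ W) W⊆X c<d | here
  with ∈-candidates d X R W (Subset.drop-∷-⊆ W⊆X) (<⇒≤ c<d)
... | zero  , eq , W∈ = contradiction eq (<⇒≢ c<d)
... | suc b , eq , W∈ = b , trans (+-suc b _) eq , ∈-extend true false W∈ (there (here refl))

-- x − 1 further vertices outside R extend a candidate with budget b to at most
-- x ^ b candidates, which makes this sum a potential.
potential : ∀ {k} → ℕ → List (Subset k × ℕ) → ℕ
potential x L = sumL (map (λ (W , b) → x ^ b) L)

private
  potential-++ : ∀ {k} x (L L′ : List (Subset k × ℕ)) → potential x (L ++ L′) ≡ potential x L + potential x L′
  potential-++ x []             L′ = refl
  potential-++ x ((W , b) ∷ L) L′ =
    trans (cong (x ^ b +_) (potential-++ x L L′)) (sym (+-assoc (x ^ b) _ _))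

  potential-ʳ++ : ∀ {k} x (L L′ : List (Subset k × ℕ)) → potential x (L ʳ++ L′) ≡ potential x L + potential x L′
  potential-ʳ++ x []            L′ = refl
  potential-ʳ++ x ((W , b) ∷ L) L′ =
    trans (potential-ʳ++ x L ((W , b) ∷ L′)) (arith (potential x L) (x ^ b) (potential x L′))
    where
    arith : ∀ p q r → p + (q + r) ≡ q + p + r
    arith = solve-∀

-- Outside `R`, leaving out and taking the vertex contribute x^(b+1) + x^b = x^b (1+x) ≤
-- (1+x)^(b+1). Only an admissible vertex of `R` leaves the budget intact in both branches and costs
-- a factor 2.
potential-branch : ∀ {k} ok r x W b →
  potential x (branch {k} ok r (W , b)) ≤ 2 ^ ∣ (ok ∧ r) ∷ [] ∣ * suc x ^ b
potential-branch false r x W b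
  rewrite +-identityʳ (x ^ b) | +-identityʳ (suc x ^ b) = ^-monoˡ-≤ b (n≤1+n x)
potential-branch true true x W b =
  *-monoʳ-≤ 2 (^-monoˡ-≤ b (n≤1+n x))
potential-branch true false x W zero = ≤-refl
potential-branch true false x W (suc b)
  rewrite +-identityʳ (x ^ b) | +-identityʳ (suc x ^ suc b) | +-comm (x ^ suc b) (x ^ b) =
  +-mono-≤ (^-monoˡ-≤ b (n≤1+n x)) (*-monoʳ-≤ x (^-monoˡ-≤ b (n≤1+n x)))

potential-extend : ∀ {k} ok r x (L : List (Subset k × ℕ)) →
  potential x (extend ok r L) ≤ 2 ^ ∣ (ok ∧ r) ∷ [] ∣ * potential (suc x) L
potential-extend ok r x L = begin
  potential x (extend ok r L)                       ≡⟨ potential-ʳ++ x (concatMap (branch ok r) L) [] ⟩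
  potential x (concatMap (branch ok r) L) + 0       ≡⟨ +-identityʳ _ ⟩
  potential x (concatMap (branch ok r) L)           ≤⟨ bound L ⟩
  f * potential (suc x) L                           ∎
  where
  open ≤-Reasoning
  f = 2 ^ ∣ (ok ∧ r) ∷ [] ∣
  bound : ∀ L → potential x (concatMap (branch ok r) L) ≤ f * potential (suc x) L
  bound []            = z≤n
  bound ((W , b) ∷ L) = begin
    potential x (branch ok r (W , b) ++ concatMap (branch ok r) L)
      ≡⟨ potential-++ x (branch ok r (W , b)) _ ⟩
    potential x (branch ok r (W , b)) + potential x (concatMap (branch ok r) L)
      ≤⟨ +-mono-≤ (potential-branch ok r x W b) (bound L) ⟩
    f * suc x ^ b + f * potential (suc x) L
      ≡⟨ *-distribˡ-+ f (suc x ^ b) _ ⟨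
    f * potential (suc x) ((W , b) ∷ L) ∎

-- `x` is general because each vertex peeled off raises it by one. At `x = 1` every candidate has
-- weight 1, and the potential is the length of the list.
potential-candidates : ∀ d x {k} (X R : Subset k) →
  potential x (candidates d X R) ≤ 2 ^ ∣ X ∩ R ∣ * (x + k) ^ d
potential-candidates d x [] [] = ≤-reflexive (cong (λ y → y ^ d + 0) (sym (+-identityʳ x)))
potential-candidates d x {suc k} (ok ∷ X) (r ∷ R) = begin
  potential x (extend ok r (candidates d X R))
    ≤⟨ potential-extend ok r x (candidates d X R) ⟩
  f * potential (suc x) (candidates d X R)
    ≤⟨ *-monoʳ-≤ f (potential-candidates d (suc x) X R) ⟩
  f * (2 ^ ∣ X ∩ R ∣ * (suc x + k) ^ d)
    ≡⟨ *-assoc f (2 ^ ∣ X ∩ R ∣) _ ⟨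
  f * 2 ^ ∣ X ∩ R ∣ * (suc x + k) ^ d
    ≡⟨ cong₂ _*_ (count (ok ∧ r)) (cong (_^ d) (sym (+-suc x k))) ⟩
  2 ^ ∣ (ok ∧ r) ∷ (X ∩ R) ∣ * (x + suc k) ^ d ∎
  where
  open ≤-Reasoning
  f = 2 ^ ∣ (ok ∧ r) ∷ [] ∣
  count : ∀ b → 2 ^ ∣ b ∷ [] ∣ * 2 ^ ∣ X ∩ R ∣ ≡ 2 ^ ∣ b ∷ (X ∩ R) ∣
  count true  = refl
  count false = +-identityʳ _

length≡potential : ∀ {k} (L : List (Subset k × ℕ)) → length L ≡ potential 1 L
length≡potential []            = refl
length≡potential ((W , b) ∷ L) = cong₂ _+_ (sym (^-zeroˡ b)) (length≡potential L)

-- Every candidate survives by leaving out the new vertex. A bound on the final list therefore holds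
-- at all earlier stages.
length-extend : ∀ {k} ok r (L : List (Subset k × ℕ)) → length L ≤ length (extend ok r L)
length-extend ok r L rewrite length-reverse (concatMap (branch ok r) L) = bound L
  where
  nonempty : ∀ ok r x → 1 ≤ length (branch ok r x)
  nonempty false r     (W , b)     = s≤s z≤n
  nonempty true  true  (W , b)     = s≤s z≤n
  nonempty true  false (W , zero)  = s≤s z≤n
  nonempty true  false (W , suc b) = s≤s z≤n
  bound : ∀ L → length L ≤ length (concatMap (branch ok r) L)
  bound []      = z≤n
  bound (x ∷ L) rewrite length-++ (branch ok r x) {concatMap (branch ok r) L} =
    +-mono-≤ (nonempty ok r x) (bound L)

-- Counting in graphs

open module ∑ = Algebra.Properties.CommutativeMonoid.Sum +-0-commutativeMonoid using (sum)

bit : Bool → ℕ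
bit true  = 1
bit false = 0

sum-mono : ∀ {n} {f g : Fin n → ℕ} → (∀ i → f i ≤ g i) → sum f ≤ sum g
sum-mono {zero}  f≤g = z≤n
sum-mono {suc n} f≤g = +-mono-≤ (f≤g zero) (sum-mono (f≤g ∘ suc))

∣tabulate∣ : ∀ {n} (f : Fin n → Bool) → ∣ tabulate f ∣ ≡ sum (bit ∘ f)
∣tabulate∣ {zero}  f = refl
∣tabulate∣ {suc n} f with f zero
... | true  = cong suc (∣tabulate∣ (f ∘ suc))
... | false = ∣tabulate∣ (f ∘ suc)

module _ {A : Set} {p} {P : Pred A p} (P? : Decidable P) where

  length-filter-tabulate : ∀ {n} (f : Fin n → A) →
    length (filter P? (tabulateL f)) ≡ sum (λ i → bit (does (P? (f i))))
  length-filter-tabulate {zero}  f = refl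
  length-filter-tabulate {suc n} f with does (P? (f zero))
  ... | true  = cong suc (length-filter-tabulate (f ∘ suc))
  ... | false = length-filter-tabulate (f ∘ suc)

length-filter-product : ∀ {A B : Set} {p} {P : Pred (A × B) p} (P? : Decidable P)
  {m n} (f : Fin m → A) (g : Fin n → B) →
  length (filter P? (cartesianProduct (tabulateL f) (tabulateL g))) ≡
  sum (λ i → sum (λ j → bit (does (P? (f i , g j)))))
length-filter-product P? {zero}  f g = refl
length-filter-product P? {suc m} f g = begin
  length (filter P? (map (f zero ,_) (tabulateL g) ++ rest))
    ≡⟨ cong length (filter-++ P? (map (f zero ,_) (tabulateL g)) rest) ⟩
  length (filter P? (map (f zero ,_) (tabulateL g)) ++ filter P? rest)
    ≡⟨ length-++ (filter P? (map (f zero ,_) (tabulateL g))) ⟩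
  length (filter P? (map (f zero ,_) (tabulateL g))) + length (filter P? rest)
    ≡⟨ cong₂ _+_
         (trans (cong (length ∘ filter P?) (map-tabulate g (f zero ,_)))
           (length-filter-tabulate P? (λ j → f zero , g j)))
         (length-filter-product P? (f ∘ suc) g) ⟩
  _ ∎
  where
  open ≡-Reasoning
  rest = cartesianProduct (tabulateL (f ∘ suc)) (tabulateL g)

-- Handshaking: an adjacent pair is an arc in one of its two orientations, and exchanging the order
-- of summation shows that both orientations have the same total.
sum-degree : ∀ G → sum (degree G) ≤ 2 * size G
sum-degree G = begin
  sum (degree G)
    ≡⟨ ∑.sum-cong-≗ (λ u → ∣tabulate∣ (adj G u)) ⟩
  sum (λ u → sum (λ v → bit (adj G u v)))
    ≤⟨ sum-mono (λ u → sum-mono (oriented u)) ⟩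
  sum (λ u → sum (λ v → arc u v + arc v u))
    ≡⟨ ∑.sum-cong-≗ (λ u → ∑.∑-distrib-+ (arc u) (λ v → arc v u)) ⟩
  sum (λ u → sum (arc u) + sum (λ v → arc v u))
    ≡⟨ ∑.∑-distrib-+ (λ u → sum (arc u)) _ ⟩
  arcs + sum (λ u → sum (λ v → arc v u))
    ≡⟨ cong (arcs +_) (trans (∑.∑-comm (λ u v → arc v u)) (sym (+-identityʳ arcs))) ⟩
  2 * arcs
    ≡⟨ cong (2 *_) (length-filter-product edge? id id) ⟨
  2 * size G ∎
  where
  open ≤-Reasoning
  edge? : ∀ (e : Vertex G × Vertex G) → Dec (proj₁ e <ᶠ proj₂ e × T (adj G (proj₁ e) (proj₂ e)))
  edge? (u , v) = (u <ᶠ? v) ×-dec T? (adj G u v)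
  arc : Vertex G → Vertex G → ℕ
  arc u v = bit (does (edge? (u , v)))
  arcs = sum (λ u → sum (arc u))
  oriented : ∀ u v → bit (adj G u v) ≤ arc u v + arc v u
  oriented u v with Fin.<-cmp u v
  ... | tri< u<v _ _ rewrite dec-true (u <ᶠ? v) u<v = m≤m+n _ _
  ... | tri> _ _ v<u rewrite dec-true (v <ᶠ? u) v<u | Graph.sym G u v = m≤n+m _ _
  ... | tri≈ _ refl _ rewrite Graph.irrefl G u = z≤n

atLeast : ∀ {n} → ℕ → (Fin n → ℕ) → Subset n
atLeast t f = tabulate (λ i → t ≤ᵇ f i)

-- Markov's inequality for the counting measure, restricted to `R`.
∣atLeast∩∣*t≤sum : ∀ {n} t (f : Fin n → ℕ) R → ∣ atLeast t f ∩ R ∣ * t ≤ sum f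
∣atLeast∩∣*t≤sum t f [] = z≤n
∣atLeast∩∣*t≤sum t f (r ∷ R) with ∣atLeast∩∣*t≤sum t (f ∘ suc) R | t ≤ᵇ f zero | ≤ᵇ⇒≤ t (f zero) | r
... | ih | true  | t≤f | true  = +-mono-≤ (t≤f _) ih
... | ih | true  | _   | false = ≤-trans ih (m≤n+m _ (f zero))
... | ih | false | _   | _     = ≤-trans ih (m≤n+m _ (f zero))

heavy : (G : Graph) → Subset (order G) → Subset (order G)
heavy G R = atLeast ∣ R ∣ (degree G)

∣heavy∩R∣²≤2m : ∀ G R → ∣ heavy G R ∩ R ∣ * ∣ heavy G R ∩ R ∣ ≤ 2 * size G
∣heavy∩R∣²≤2m G R = begin
  h * h             ≤⟨ *-monoʳ-≤ h (Subset.∣p∩q∣≤∣q∣ (heavy G R) R) ⟩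
  h * ∣ R ∣         ≤⟨ ∣atLeast∩∣*t≤sum ∣ R ∣ (degree G) R ⟩
  sum (degree G)    ≤⟨ sum-degree G ⟩
  2 * size G        ∎
  where
  open ≤-Reasoning
  h = ∣ heavy G R ∩ R ∣

-- The pivot of a solution

minimum : ∀ {k} (f : Fin k → ℕ) → k ≡ 0 ⊎ ∃ λ i → ∀ j → f i ≤ f j
minimum {zero}  f = inj₁ refl
minimum {suc k} f with minimum (f ∘ suc)
... | inj₁ refl = inj₂ (zero , λ { zero → ≤-refl })
... | inj₂ (i , least) with ≤-total (f zero) (f (suc i))
...   | inj₁ ≤i = inj₂ (zero , λ { zero → ≤-refl ; (suc j) → ≤-trans ≤i (least j) })
...   | inj₂ i≤ = inj₂ (suc i , λ { zero → i≤ ; (suc j) → least j })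

element-surjective : ∀ {n} {W : Subset n} {u} → u ∈ₛ W → ∃ λ j → element W j ≡ u
element-surjective here = zero , refl
element-surjective {W = inside ∷ W} (there u∈W) with j , refl ← element-surjective u∈W = suc j , refl
element-surjective {W = outside ∷ W} (there u∈W) with j , refl ← element-surjective u∈W = j , refl

-- For `f = adj G v` with v in `W`, the left side is the degree of v in `induced G W`.
∣tabulate-element∣ : ∀ {n} (W : Subset n) (f : Fin n → Bool) →
  ∣ tabulate (f ∘ element W) ∣ ≡ ∣ W ∩ tabulate f ∣
∣tabulate-element∣ []            f = refl
∣tabulate-element∣ (outside ∷ W) f = ∣tabulate-element∣ W (f ∘ suc)
∣tabulate-element∣ (inside ∷ W)  f with f zero
... | true  = cong suc (∣tabulate-element∣ W (f ∘ suc))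
... | false = ∣tabulate-element∣ W (f ∘ suc)

∣∩∣+∣∩∁∣ : ∀ {n} (W R : Subset n) → ∣ W ∩ R ∣ + ∣ W ∩ ∁ R ∣ ≡ ∣ W ∣
∣∩∣+∣∩∁∣ []            []      = refl
∣∩∣+∣∩∁∣ (outside ∷ W) (r ∷ R) = ∣∩∣+∣∩∁∣ W R
∣∩∣+∣∩∁∣ (inside ∷ W)  (true ∷ R)  = cong suc (∣∩∣+∣∩∁∣ W R)
∣∩∣+∣∩∁∣ (inside ∷ W)  (false ∷ R) = trans (+-suc _ _) (cong suc (∣∩∣+∣∩∁∣ W R))

pivots : (G : Graph) → List (Subset (order G))
pivots G = ∅ ∷ tabulateL (neighbours G)

∈-atLeast : ∀ {n t} {f : Fin n → ℕ} {i} → t ≤ f i → i ∈ₛ atLeast t f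
∈-atLeast {f = f} {i} t≤ =
  lookup⇒[]= i _ (trans (lookup∘tabulate _ i) (Equivalence.to T-≡ (≤⇒≤ᵇ t≤)))

-- Density is applied at the chosen vertex: at least |W| ∸ d vertices of `W` are its neighbours, so
-- at most `d` of them miss `R`. Minimality of its degree in `G` makes all of `W` heavy.
pivot : ∀ G d W → MinDegreeAtLeast (induced G W) (∣ W ∣ ∸ d) →
  ∃ λ R → R ∈ₗ pivots G × W ⊆ heavy G R × ∣ W ∩ ∁ R ∣ ≤ d
pivot G d W dense with minimum (degree G ∘ element W)
... | inj₁ empty = ∅ , here refl
  , (λ _ → ∈-atLeast (≤-trans (≤-reflexive (Subset.∣⊥∣≡0 (order G))) z≤n))
  , ≤-trans (m≤n+m _ ∣ W ∩ ∅ ∣) (≤-trans (≤-reflexive (trans (∣∩∣+∣∩∁∣ W ∅) empty)) z≤n)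
... | inj₂ (i , least) = R , there (∈-tabulate⁺ (element W i)) , light⊆ , few
  where
  R = neighbours G (element W i)
  light⊆ : W ⊆ heavy G R
  light⊆ u∈W with j , refl ← element-surjective u∈W = ∈-atLeast (least j)
  few : ∣ W ∩ ∁ R ∣ ≤ d
  few = +-cancelˡ-≤ ∣ W ∩ R ∣ _ _ (begin
    ∣ W ∩ R ∣ + ∣ W ∩ ∁ R ∣        ≡⟨ ∣∩∣+∣∩∁∣ W R ⟩
    ∣ W ∣                          ≤⟨ m≤n+m∸n ∣ W ∣ d ⟩
    d + (∣ W ∣ ∸ d)                ≤⟨ +-monoʳ-≤ d (dense i) ⟩
    d + degree (induced G W) i     ≡⟨ cong (d +_) (∣tabulate-element∣ W (adj G (element W i))) ⟩
    d + ∣ W ∩ R ∣                  ≡⟨ +-comm d _ ⟩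
    ∣ W ∩ R ∣ + d                  ∎)
    where open ≤-Reasoning

-- Programs

encodeVec : ∀ {A : Set} {n} → (A → Tree) → Vec A n → Tree
encodeVec enc v = encodeList (map enc (toList v))

encodeBits : ∀ {n} → Subset n → Tree
encodeBits = encodeVec encodeBool

truth : Tree → Bool
truth nil     = false
truth (_ · _) = true

positive : ℕ → Bool
positive n = truth (encodeℕ n)

truth-encodeBool : ∀ b → truth (encodeBool b) ≡ b
truth-encodeBool true  = refl
truth-encodeBool false = refl

positive-∸ : ∀ m n → positive (m ∸ n) ≡ (n <ᵇ m)
positive-∸ zero    zero    = refl
positive-∸ zero    (suc n) = refl
positive-∸ (suc m) zero    = refl
positive-∸ (suc m) (suc n) = positive-∸ m n

<ᵇ-suc : ∀ m n → (m <ᵇ suc n) ≡ (m ≤ᵇ n)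
<ᵇ-suc zero    n = refl
<ᵇ-suc (suc m) n = refl

trueᵉ : Exp 1
trueᵉ = cons nil nil

-- A loop walks one list only, so the other one travels in the state. Argument: x · (remaining ys ·
-- pairs so far).
zipStep : Exp 1
zipStep = cons (tl (hd (tl arg))) (cons (cons (hd arg) (hd (hd (tl arg)))) (tl (tl arg)))

zipReversed : Fn
zipReversed =
  ret (cons (hd arg) (cons (tl arg) nil)) »
  loop short (ret zipStep) »
  ret (tl arg)

-- The pairs come out reversed, so the left fold of `loop` acts as a right fold on the original
-- order, matching the recursion on vectors in `candidates`.
zipFold : Fn → Fn
zipFold f = bind (hd arg) zipReversed » ret (cons (hd arg) (tl (tl arg))) » loop short f

-- p · q ↦ 1 + ∣ p ∣ ∸ ∣ q ∣ in unary, which is not nil iff ∣ q ∣ ≤ ∣ p ∣.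
atLeastᶠ : Fn
atLeastᶠ =
  bind (cons (hd arg) trueᵉ) (loop short (cond (hd arg) (ret (cons nil (tl arg))) (ret (tl arg)))) »
  ret (cons (tl (tl arg)) (hd arg)) »
  loop short (cond (hd arg) (ret (tl (tl arg))) (ret (tl arg)))

-- W · K ↦ K ∸ ∣ ∁ W ∣ in unary, which is not `nil` iff fewer than K vertices are deleted.
withinᶠ : Fn
withinᶠ = loop short (cond (hd arg) (ret (tl arg)) (ret (tl (tl arg))))

selectᶠ : Fn
selectᶠ =
  ret (cons arg nil) »
  zipFold (cond (hd (hd arg)) (ret (cons (tl (hd arg)) (tl arg))) (ret (tl arg)))

-- The state of the fold is W · the rows of G[W] built so far.
inducedᶠ : Fn
inducedᶠ =
  ret (cons arg (cons (hd arg) nil)) »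
  zipFold
    (cond (hd (hd arg))
      (bind (cons (hd (tl arg)) (tl (hd arg))) selectᶠ »
       ret (cons (hd (tl (tl arg))) (cons (hd arg) (tl (tl (tl arg))))))
      (ret (tl arg))) »
  ret (tl arg)

-- The flags are parameters of the program text: they are tested once per vertex, outside the loop
-- over candidates.
branchᶠ : Bool → Bool → Fn
branchᶠ = go
  where
  excluded included : Exp 1 → Exp 1
  excluded b = cons (cons nil (hd (hd arg))) b
  included b = cons (cons trueᵉ (hd (hd arg))) b
  budget = tl (hd arg)
  go : Bool → Bool → Fn
  go false _     = ret (cons (excluded budget) (tl arg))
  go true  true  = ret (cons (included budget) (cons (excluded budget) (tl arg)))
  go true  false = cond budget
    (ret (cons (included (tl budget)) (cons (excluded budget) (tl arg))))
    (ret (cons (excluded budget) (tl arg)))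

-- Argument: c · (row · r) · R · candidates, with c the result of atLeastᶠ.
extendᶠ : Bool → Bool → Fn
extendᶠ ok r =
  bind (cons (tl (tl (tl arg))) nil) (loop long (branchᶠ ok r)) »
  ret (cons (hd (tl (tl (tl arg)))) (hd arg))

candidatesᶠ : Fn
candidatesᶠ =
  zipFold
    (bind (cons (hd (hd arg)) (hd (tl arg))) atLeastᶠ »
     cond (hd arg)
       (cond (tl (hd (tl arg))) (extendᶠ true true) (extendᶠ true false))
       (extendᶠ false false))

-- Argument: (W · b) · (rows · K) · answer, with K = 1 + k if k ≥ 0 and K = 0
-- otherwise, so that the deleted vertices must number less than K.
testᶠ : Fn
testᶠ =
  bind (cons (hd (hd arg)) (tl (hd (tl arg)))) withinᶠ »
  cond (hd arg)
    (bind (cons (hd (hd (tl arg))) (hd (hd (tl (tl arg))))) (inducedᶠ » oracle) »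
     cond (hd arg) (ret (cons (hd (tl (tl (tl arg)))) trueᵉ)) (ret (tl (tl (tl arg)))))
    (ret (tl (tl arg)))

numeral : ℕ → Exp 1
numeral zero    = nil
numeral (suc n) = cons nil (numeral n)

-- Argument: R · (rows · K) · answer.
pivotᶠ : ℕ → Fn
pivotᶠ d =
  bind (cons (cons (hd (hd (tl arg))) (hd arg)) (cons (hd arg) (cons (cons nil (numeral d)) nil)))
    candidatesᶠ »
  ret (cons (tl (hd arg)) (tl (tl arg))) »
  loop long testᶠ

-- A row of the adjacency matrix already encodes a neighbourhood. The list of pivots is thus the
-- input matrix with an all-false row in front, which the second line builds.
solve : ℕ → Fn
solve d =
  cond (hd (tl arg)) (ret (cons (hd arg) nil)) (ret (cons (hd arg) (cons nil (tl (tl arg))))) »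
  bind (cons (hd arg) nil) (loop short (ret (cons nil (tl arg)))) »
  ret (cons (cons (hd arg) (hd (tl arg))) (cons (tl arg) nil)) »
  loop short (pivotᶠ d) »
  ret (tl arg)

-- Values computed by the programs, and their encodings.

select : ∀ {A : Set} {n} → Subset n → Vec A n → List A
select W xs = foldr pick [] (toList (zip W xs))
  where
  pick : _ → List _ → List _
  pick (true  , x) ys = x ∷ ys
  pick (false , x) ys = ys

select-tabulate : ∀ {A : Set} {n} (W : Subset n) (f : Fin n → A) →
  select W (tabulate f) ≡ tabulateL (f ∘ element W)
select-tabulate []          f = refl
select-tabulate (true ∷ W)  f = cong (f zero ∷_) (select-tabulate W (f ∘ suc))
select-tabulate (false ∷ W) f = select-tabulate W (f ∘ suc)

encodeCandidate : ∀ {n} → Subset n × ℕ → Tree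
encodeCandidate (W , b) = encodeBits W · encodeℕ b

encodeCandidates : ∀ {n} → List (Subset n × ℕ) → Tree
encodeCandidates = encodeList ∘ map encodeCandidate

allowance : ℤ → ℕ
allowance (ℤ.+ k)    = suc k
allowance -[1+ k ] = 0

value-numeral : ∀ n x → value (numeral n) x ≡ encodeℕ n
value-numeral zero    x = refl
value-numeral (suc n) x = cong (nil ·_) (value-numeral n x)

foldl-branch : ∀ {k} ok r (L : List (Subset k × ℕ)) out →
  foldl (λ out x → branch ok r x ʳ++ out) out L ≡ concatMap (branch ok r) L ʳ++ out
foldl-branch ok r []      out = refl
foldl-branch ok r (x ∷ L) out =
  trans (foldl-branch ok r L (branch ok r x ʳ++ out)) (sym (++-ʳ++ (branch ok r x)))

encodeRows : List (List Bool) → Tree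
encodeRows = encodeList ∘ map (encodeList ∘ map encodeBool)

matrix : (G : Graph) → Vec (Subset (order G)) (order G)
matrix G = tabulate (neighbours G)

tabulateL-toList : ∀ {A : Set} {n} (f : Fin n → A) → toList (tabulate f) ≡ tabulateL f
tabulateL-toList {n = zero}  f = refl
tabulateL-toList {n = suc n} f = cong (f zero ∷_) (tabulateL-toList (f ∘ suc))

encodeGraph-tabulate : ∀ G →
  encodeGraph G ≡ encodeRows (tabulateL (λ u → tabulateL (adj G u)))
encodeGraph-tabulate G = cong encodeList (trans (map-tabulate id _)
  (trans (tabulate-cong λ u → cong encodeList (trans (map-tabulate id _) (sym (map-tabulate (adj G u) encodeBool))))
    (sym (map-tabulate (λ u → tabulateL (adj G u)) _))))

encodeGraph-matrix : ∀ G → encodeGraph G ≡ encodeVec encodeBits (matrix G)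
encodeGraph-matrix G = trans (encodeGraph-tabulate G) (cong encodeList (trans
  (trans (map-tabulate _ _) (trans (tabulate-cong λ u →
    cong (encodeList ∘ map encodeBool) (sym (tabulateL-toList (adj G u))))
      (sym (map-tabulate (neighbours G) encodeBits))))
  (cong (map encodeBits) (sym (tabulateL-toList (neighbours G))))))

-- The oracle must see `induced G W` itself, since Π may tell it from an isomorphic copy. Rows and
-- columns kept in increasing order agree with the numbering by `element`.
encodeGraph-induced : ∀ G W →
  encodeRows (map (select W) (select W (matrix G))) ≡ encodeGraph (induced G W)
encodeGraph-induced G W = trans
  (cong encodeRows (trans (cong (map (select W)) (select-tabulate W (neighbours G)))
    (trans (map-tabulate _ (select W)) (tabulate-cong λ i → select-tabulate W (adj G (element W i))))))
  (sym (encodeGraph-tabulate (induced G W)))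

-- Correctness of the programs.

module Correct {e : ℕ} (Q : Cmd (suc e)) (A a : ℕ) (M B : ℕ) where

  open Machine Q A a
  open Run M B

  ⇒-if : ∀ {ex f g x} (F : Bool → Tree) b → truth (value ex x) ≡ b →
    f ⊢ x ⇒ F true → g ⊢ x ⇒ F false → cond ex f g ⊢ x ⇒ F b
  ⇒-if {ex} {f} {g} {x} F b eq F⇒ G⇒ with value ex x in eq′
  ⇒-if {ex} {f} {g} F .true  refl F⇒ G⇒ | u · v = ⇒-true {ex} {f} {g} eq′ F⇒
  ⇒-if {ex} {f} {g} F .false refl F⇒ G⇒ | nil   = ⇒-false {ex} {f} {g} eq′ G⇒

  ⇒-≡ : ∀ {f x y z} → y ≡ z → f ⊢ x ⇒ y → f ⊢ x ⇒ z
  ⇒-≡ refl F = F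

  ⇒-fold : ∀ {A S : Set} (enc : A → Tree) (encS : S → Tree) (g : A → S → S) {r f} →
    (∀ x s → f ⊢ enc x · encS s ⇒ encS (g x s)) →
    ∀ xs {s} → length xs < limit M B r →
    loop r f ⊢ encodeList (map enc xs) · encS s ⇒ encS (foldl (flip g) s xs)
  ⇒-fold enc encS g body xs len =
    ⇒-loop (λ _ _ → ⊤) enc encS g (λ _ → body _ _ , _) xs len _

  module _ {n} (n<M : n < M) where

    short-toList : ∀ {A : Set} (xs : Vec A n) → length (toList xs) < M
    short-toList xs rewrite length-toList xs = n<M

    module _ {A C : Set} {encA : A → Tree} {encC : C → Tree} where

      encodePair : A × C → Tree
      encodePair (x , y) = encA x · encC y

      ⇒-zipReversed : (xs : Vec A n) (ys : Vec C n) →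
        zipReversed ⊢ encodeVec encA xs · encodeVec encC ys ⇒
          encodeList (map encodePair (reverse (toList (zip xs ys))))
      ⇒-zipReversed xs ys =
        ⇒-ret ⇒-»
        ⇒-fold encA id (λ x s → value zipStep (encA x · s)) (λ _ _ → ⇒-ret) (toList xs) (short-toList xs) ⇒-»
        ⇒-≡ (cong right (zipped xs ys [])) ⇒-ret
        where
        zipped : ∀ {m} (xs : Vec A m) (ys : Vec C m) zs →
          foldl (λ s x → value zipStep (encA x · s)) (encodeVec encC ys · encodeList (map encodePair zs)) (toList xs) ≡
          nil · encodeList (map encodePair (toList (zip xs ys) ʳ++ zs))
        zipped []       []       zs = refl
        zipped (x ∷ xs) (y ∷ ys) zs = zipped xs ys ((x , y) ∷ zs)

      -- The pairs processed so far always form a suffix `done` of the zipped list, and the state is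
      -- the right fold over it. `P`, assumed of the whole list, therefore only has to pass to
      -- tails.
      ⇒-zipFold : ∀ {S : Set} (P : List (A × C) → Set) (encS : S → Tree) (g : A × C → S → S) {f s} →
        (∀ z zs → P (z ∷ zs) → P zs) →
        (∀ x y zs → P ((x , y) ∷ zs) →
          f ⊢ (encA x · encC y) · encS (foldr g s zs) ⇒ encS (g (x , y) (foldr g s zs))) →
        (xs : Vec A n) (ys : Vec C n) → P (toList (zip xs ys)) →
        zipFold f ⊢ (encodeVec encA xs · encodeVec encC ys) · encS s ⇒ encS (foldr g s (toList (zip xs ys)))
      ⇒-zipFold {S} P encS g {f} {s} tail body xs ys all =
        ⇒-bind (⇒-zipReversed xs ys) ⇒-» ⇒-ret ⇒-»
        ⇒-≡ (cong encS (reverse-foldl (flip g) s zs))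
          (⇒-loop Inv encodePair encS g (λ {_} {todo} → step {todo = todo}) (reverse zs) len
            ([] , refl , subst P (sym reversed) all))
        where
        zs = toList (zip xs ys)
        Inv : List (A × C) → S → Set
        Inv todo s′ = ∃ λ done → s′ ≡ foldr g s done × P (todo ʳ++ done)
        suffix : ∀ todo {done} → P (todo ʳ++ done) → P done
        suffix []         p = p
        suffix (z ∷ todo) p = tail _ _ (suffix todo p)
        step : ∀ {z todo s′} → Inv (z ∷ todo) s′ →
          (f ⊢ encodePair z · encS s′ ⇒ encS (g z s′)) × Inv todo (g z s′)
        step {z} {todo} (done , refl , p) = body _ _ done (suffix todo p) , z ∷ done , refl , p
        reversed : reverse zs ʳ++ [] ≡ zs
        reversed = reverse-involutive zs
        len : length (reverse zs) < M
        len rewrite length-reverse zs = short-toList (zip xs ys)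

    up down : Bool → ℕ → ℕ
    up true  s = suc s
    up false s = s
    down true  s = s ∸ 1
    down false s = s

    ∣∣-up : ∀ {m} (p : Subset m) s → foldl (flip up) s (toList p) ≡ ∣ p ∣ + s
    ∣∣-up []          s = refl
    ∣∣-up (true ∷ p)  s = trans (∣∣-up p (suc s)) (+-suc _ s)
    ∣∣-up (false ∷ p) s = ∣∣-up p s

    ∣∣-down : ∀ {m} (p : Subset m) s → foldl (flip down) s (toList p) ≡ s ∸ ∣ p ∣
    ∣∣-down []          s = refl
    ∣∣-down (true ∷ p)  s = trans (∣∣-down p (s ∸ 1)) (∸-+-assoc s 1 ∣ p ∣)
    ∣∣-down (false ∷ p) s = ∣∣-down p s

    ∣∁∣-down : ∀ {m} (p : Subset m) s → foldl (flip (down ∘ not)) s (toList p) ≡ s ∸ ∣ ∁ p ∣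
    ∣∁∣-down []          s = refl
    ∣∁∣-down (true ∷ p)  s = ∣∁∣-down p s
    ∣∁∣-down (false ∷ p) s = trans (∣∁∣-down p (s ∸ 1)) (∸-+-assoc s 1 ∣ ∁ p ∣)

    encode-pred : ∀ s → right (encodeℕ s) ≡ encodeℕ (s ∸ 1)
    encode-pred zero    = refl
    encode-pred (suc s) = refl

    ⇒-atLeast : (p q : Subset n) → atLeastᶠ ⊢ encodeBits p · encodeBits q ⇒ encodeℕ (suc ∣ p ∣ ∸ ∣ q ∣)
    ⇒-atLeast p q =
      ⇒-bind (⇒-≡ (cong encodeℕ (trans (∣∣-up p 1) (+-comm _ 1)))
        (⇒-fold encodeBool encodeℕ up counted (toList p) (short-toList p))) ⇒-»
      ⇒-ret ⇒-»
      ⇒-≡ (cong encodeℕ (∣∣-down q _))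
        (⇒-fold encodeBool encodeℕ down uncounted (toList q) (short-toList q))
      where
      counted : ∀ b s → _ ⊢ encodeBool b · encodeℕ s ⇒ encodeℕ (up b s)
      counted true  s = ⇒-true refl ⇒-ret
      counted false s = ⇒-false refl ⇒-ret
      uncounted : ∀ b s → _ ⊢ encodeBool b · encodeℕ s ⇒ encodeℕ (down b s)
      uncounted true  s = ⇒-true refl (⇒-≡ (encode-pred s) ⇒-ret)
      uncounted false s = ⇒-false refl ⇒-ret

    ⇒-within : (p : Subset n) (s : ℕ) → withinᶠ ⊢ encodeBits p · encodeℕ s ⇒ encodeℕ (s ∸ ∣ ∁ p ∣)
    ⇒-within p s =
      ⇒-≡ (cong encodeℕ (∣∁∣-down p s))
        (⇒-fold encodeBool encodeℕ (down ∘ not) counted (toList p) (short-toList p))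
      where
      counted : ∀ b s → _ ⊢ encodeBool b · encodeℕ s ⇒ encodeℕ (down (not b) s)
      counted true  s = ⇒-true refl ⇒-ret
      counted false s = ⇒-false refl (⇒-≡ (encode-pred s) ⇒-ret)

    ⇒-select : ∀ {A : Set} (enc : A → Tree) (W : Subset n) (xs : Vec A n) →
      selectᶠ ⊢ encodeBits W · encodeVec enc xs ⇒ encodeList (map enc (select W xs))
    ⇒-select enc W xs =
      ⇒-ret ⇒-» ⇒-zipFold (λ _ → ⊤) (encodeList ∘ map enc) _ _
        (λ { true _ _ _ → ⇒-true refl ⇒-ret ; false _ _ _ → ⇒-false refl ⇒-ret }) W xs _

    ⇒-induced : (W : Subset n) (rows : Vec (Subset n) n) →
      inducedᶠ ⊢ encodeBits W · encodeVec encodeBits rows ⇒ encodeRows (map (select W) (select W rows))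
    ⇒-induced W rows =
      ⇒-ret ⇒-»
      ⇒-zipFold (λ _ → ⊤) (λ s → encodeBits W · encodeRows s) keep _ kept W rows _ ⇒-»
      ⇒-≡ (cong encodeRows (selected W rows)) ⇒-ret
      where
      keep : Bool × Subset n → List (List Bool) → List (List Bool)
      keep (true  , row) s = select W row ∷ s
      keep (false , row) s = s
      kept : ∀ b row zs → ⊤ → _ ⊢ (encodeBool b · encodeBits row) · encodeBits W · encodeRows (foldr keep [] zs) ⇒
        encodeBits W · encodeRows (keep (b , row) (foldr keep [] zs))
      kept true row zs _ = ⇒-true refl (⇒-bind (⇒-select encodeBool W row) ⇒-» ⇒-ret)
      kept false row zs _ = ⇒-false refl ⇒-ret
      selected : ∀ {m} (V : Subset m) (rows : Vec (Subset n) m) →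
        foldr keep [] (toList (zip V rows)) ≡ map (select W) (select V rows)
      selected []          []           = refl
      selected (true ∷ V)  (row ∷ rows) = cong (select W row ∷_) (selected V rows)
      selected (false ∷ V) (row ∷ rows) = selected V rows

    ⇒-branch : ∀ ok r {k} (x : Subset k × ℕ) out →
      branchᶠ ok r ⊢ encodeCandidate x · encodeCandidates out ⇒ encodeCandidates (branch ok r x ʳ++ out)
    ⇒-branch false r     x             out = ⇒-ret
    ⇒-branch true  true  x             out = ⇒-ret
    ⇒-branch true  false (W , zero)    out = ⇒-false refl ⇒-ret
    ⇒-branch true  false (W , suc b)   out = ⇒-true refl ⇒-ret

    ⇒-extend : ∀ ok r {k} (L : List (Subset k × ℕ)) {c z x} → length L < B →
      extendᶠ ok r ⊢ c · z · x · encodeCandidates L ⇒ x · encodeCandidates (extend ok r L)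
    ⇒-extend ok r L len =
      ⇒-bind (⇒-≡ (cong encodeCandidates (foldl-branch ok r L []))
        (⇒-fold encodeCandidate encodeCandidates (λ x out → branch ok r x ʳ++ out) (⇒-branch ok r) L len)) ⇒-»
      ⇒-ret

    module _ (d : ℕ) (R : Subset n) where

      -- A fold has one state type, although the candidates grow in length with each vertex.
      Stage : Set
      Stage = Σ ℕ λ k → List (Subset k × ℕ)

      stage : Subset n × Bool → Stage → Stage
      stage (row , r) (k , L) = suc k , extend (∣ R ∣ ≤ᵇ ∣ row ∣) r L

      start : Stage
      start = 0 , ([] , d) ∷ []

      encodeStage : Stage → Tree
      encodeStage (k , L) = encodeBits R · encodeCandidates L

      -- `f` is general for the induction. At `f = neighbours G` and `m = order G` the flags are
      -- `heavy G R` by definition.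
      stages : ∀ {m} (f : Fin m → Subset n) (R′ : Subset m) →
        foldr stage start (toList (zip (tabulate f) R′)) ≡
        (m , candidates d (atLeast ∣ R ∣ (∣_∣ ∘ f)) R′)
      stages f []       = refl
      stages f (r ∷ R′) = cong (stage (f zero , r)) (stages (f ∘ suc) R′)

      ⇒-candidates : ∀ f → length (candidates d (atLeast ∣ R ∣ (∣_∣ ∘ f)) R) < B →
        candidatesᶠ ⊢ (encodeVec encodeBits (tabulate f) · encodeBits R) · encodeStage start ⇒
          encodeBits R · encodeCandidates (candidates d (atLeast ∣ R ∣ (∣_∣ ∘ f)) R)
      ⇒-candidates f len =
        ⇒-≡ (cong encodeStage (stages f R))
          (⇒-zipFold Few encodeStage stage fewer body (tabulate f) R
            (subst (λ s → length (proj₂ s) < B) (sym (stages f R)) len))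
        where
        Few : List (Subset n × Bool) → Set
        Few zs = length (proj₂ (foldr stage start zs)) < B
        fewer : ∀ z zs → Few (z ∷ zs) → Few zs
        fewer (row , r) zs few = ≤-<-trans (length-extend _ r (proj₂ (foldr stage start zs))) few
        body : ∀ row r zs → Few ((row , r) ∷ zs) →
          _ ⊢ (encodeBits row · encodeBool r) · encodeStage (foldr stage start zs) ⇒
            encodeStage (stage (row , r) (foldr stage start zs))
        body row r zs few =
          ⇒-bind (⇒-atLeast row R) ⇒-»
          ⇒-if (λ ok → encodeBits R · encodeCandidates (extend ok r L)) (∣ R ∣ ≤ᵇ ∣ row ∣)
            (trans (positive-∸ (suc ∣ row ∣) ∣ R ∣) (<ᵇ-suc ∣ R ∣ ∣ row ∣))
            (⇒-if (λ r → encodeBits R · encodeCandidates (extend true r L)) r (truth-encodeBool r)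
              (⇒-extend true true L len′) (⇒-extend true false L len′))
            (⇒-extend false false L len′)
          where
          L = proj₂ (foldr stage start zs)
          len′ : length L < B
          len′ = fewer (row , r) zs few

  module _ (G : Graph) (n<M : 1 + order G < M) (member : Subset (order G) → Bool)
    (consult : ∀ W → oracle ⊢ encodeGraph (induced G W) ⇒ encodeBool (member W))
    (d K : ℕ) (few : ∀ R → length (candidates d (heavy G R) R) < B) where

    accepts : Subset (order G) → Bool
    accepts W = (∣ ∁ W ∣ <ᵇ K) ∧ member W

    environment : Tree
    environment = encodeVec encodeBits (matrix G) · encodeℕ K

    state : Bool → Tree
    state answer = environment · encodeBool answer

    try : Subset (order G) × ℕ → Bool → Bool
    try (W , _) answer = accepts W ∨ answer

    tryAll : Subset (order G) → Bool → Bool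
    tryAll R answer = foldl (flip try) answer (candidates d (heavy G R) R)

    ⇒-test : ∀ x answer → testᶠ ⊢ encodeCandidate x · state answer ⇒ state (try x answer)
    ⇒-test (W , b) answer =
      ⇒-bind (⇒-within (<⇒≤ n<M) W K) ⇒-»
      ⇒-if (λ within → state ((within ∧ member W) ∨ answer)) (∣ ∁ W ∣ <ᵇ K) (positive-∸ K ∣ ∁ W ∣)
        (⇒-bind (⇒-≡ (encodeGraph-induced G W) (⇒-induced (<⇒≤ n<M) W (matrix G)) ⇒-» consult W) ⇒-»
         ⇒-if (λ found → state (found ∨ answer)) (member W) (truth-encodeBool (member W)) ⇒-ret ⇒-ret)
        ⇒-ret

    ⇒-pivot : ∀ R answer → pivotᶠ d ⊢ encodeBits R · state answer ⇒ state (tryAll R answer)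
    ⇒-pivot R answer =
      ⇒-bind (subst (λ t → candidatesᶠ ⊢ (encodeVec encodeBits (matrix G) · encodeBits R) · encodeBits R · (nil · t) · nil ⇒
                            encodeBits R · encodeCandidates (candidates d (heavy G R) R))
        (sym (value-numeral d _)) (⇒-candidates (<⇒≤ n<M) d R (neighbours G) (few R))) ⇒-»
      ⇒-ret ⇒-»
      ⇒-fold encodeCandidate state try ⇒-test (candidates d (heavy G R) R) (few R)

    result : Bool
    result = foldl (flip tryAll) false (pivots G)

-- Correctness of the answer.

reflects-map : ∀ {a b} {A : Set a} {B : Set b} {x} → (A → B) → (B → A) → Reflects A x → Reflects B x
reflects-map to from (ofʸ a)  = ofʸ (to a)
reflects-map to from (ofⁿ ¬a) = ofⁿ (¬a ∘ from)

-- The meaning `X` of the initial answer is arbitrary so that the lemma nests: the fold over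
-- candidates starts from the answer of the fold over pivots.
foldl-reflects : ∀ {p} {A : Set} {P : A → Set p} (g : A → Bool → Bool) →
  (∀ x {X : Set p} {b} → Reflects X b → Reflects (X ⊎ P x) (g x b)) →
  ∀ {X : Set p} {b} → Reflects X b → ∀ xs → Reflects (X ⊎ Any P xs) (foldl (flip g) b xs)
foldl-reflects g step r []       = reflects-map inj₁ (λ { (inj₁ x) → x }) r
foldl-reflects g step r (x ∷ xs) = reflects-map
  (λ { (inj₁ (inj₁ y)) → inj₁ y ; (inj₁ (inj₂ p)) → inj₂ (here p) ; (inj₂ ps) → inj₂ (there ps) })
  (λ { (inj₁ y) → inj₁ (inj₁ y) ; (inj₂ (here p)) → inj₁ (inj₂ p) ; (inj₂ (there ps)) → inj₂ ps })
  (foldl-reflects g step (step x r) xs)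

∁-involutive : ∀ {n} (p : Subset n) → ∁ (∁ p) ≡ p
∁-involutive {n} = ¬-involutive
  where open import Algebra.Lattice.Properties.BooleanAlgebra (Subset.∪-∩-booleanAlgebra n)

<allowance⁺ : ∀ {s} k → ℤ.+ s ℤ.≤ k → s < allowance k
<allowance⁺ (ℤ.+ k) (ℤ.+≤+ s≤k) = s≤s s≤k

<allowance⁻ : ∀ {s} k → s < allowance k → ℤ.+ s ℤ.≤ k
<allowance⁻ (ℤ.+ k) (s≤s s≤k) = ℤ.+≤+ s≤k

module _ {e : ℕ} (Q : Cmd (suc e)) (A a : ℕ) (M B : ℕ) where

  open Machine Q A a
  open Run M B
  open Correct Q A a M B

  module _ {ℓ} (Π : GraphProperty ℓ) (d : ℕ) (dense : ∀ G → G ∈ Π → MinDegreeAtLeast G (order G ∸ d))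
    (G : Graph) (n<M : 1 + order G < M) (member : Subset (order G) → Bool)
    (consult : ∀ W → oracle ⊢ encodeGraph (induced G W) ⇒ encodeBool (member W))
    (correct : ∀ W → Reflects (induced G W ∈ Π) (member W))
    (few : ∀ R → length (candidates d (heavy G R) R) < B) (k : ℤ) where

    answer : Bool
    answer = result G n<M member consult d (allowance k) few

    ⇒-solve : solve d ⊢ encodeInstance (G , k) ⇒ encodeBool answer
    ⇒-solve =
      ⇒-≡ (cong (_· encodeℕ K) (encodeGraph-matrix G)) (budgeted k) ⇒-»
      ⇒-bind (⇒-≡ (cong (λ j → encodeBits {j} ∅) zeros)
        (⇒-fold encodeBits (λ j → encodeBits {j} ∅) (λ _ j → suc j) (λ _ _ → ⇒-ret)
          (toList (matrix G)) (short-toList (<⇒≤ n<M) (matrix G)))) ⇒-»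
      ⇒-≡ (cong (λ rows → (encodeBits {order G} ∅ · encodeList (map encodeBits rows)) ·
          (encodeVec encodeBits (matrix G) · encodeℕ K) · nil)
        (tabulateL-toList (neighbours G))) ⇒-ret ⇒-»
      ⇒-fold encodeBits (state G n<M member consult d K few) (tryAll G n<M member consult d K few)
        (⇒-pivot G n<M member consult d K few) (pivots G)
        (subst (λ l → suc l < M) (sym (length-tabulate (neighbours G))) n<M) ⇒-»
      ⇒-ret
      where
      K = allowance k
      budgeted : ∀ k → cond (hd (tl arg)) (ret (cons (hd arg) nil)) (ret (cons (hd arg) (cons nil (tl (tl arg)))))
        ⊢ encodeInstance (G , k) ⇒ encodeGraph G · encodeℕ (allowance k)
      budgeted (ℤ.+ k)    = ⇒-false refl ⇒-ret
      budgeted -[1+ k ] = ⇒-true refl ⇒-ret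
      count : ∀ {A : Set} (xs : List A) j → foldl (λ j _ → suc j) j xs ≡ length xs + j
      count []       j = refl
      count (x ∷ xs) j = trans (count xs (suc j)) (+-suc _ j)
      zeros : foldl (λ j _ → suc j) 0 (toList (matrix G)) ≡ order G
      zeros = trans (count (toList (matrix G)) 0) (trans (+-identityʳ _) (length-toList (matrix G)))

    Accepted : Subset (order G) → Set ℓ
    Accepted W = (∣ ∁ W ∣ < allowance k) × (induced G W ∈ Π)

    Hit : Subset (order G) → Set ℓ
    Hit R = Any (Accepted ∘ proj₁) (candidates d (heavy G R) R)

    -- Soundness holds because each candidate is tested, with `∁ W` as the deleted set. Density
    -- enters through completeness: for W = ∁ S, `pivot` supplies `R` and `∈-candidates` finds W in
    -- its list.
    answer-reflects : Reflects (VertexDeletion Π (G , k)) answer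
    answer-reflects = reflects-map sound complete
      (foldl-reflects (tryAll G n<M member consult d (allowance k) few)
        (λ R r → foldl-reflects (try G n<M member consult d (allowance k) few) tried r (candidates d (heavy G R) R))
        ⊥-reflects (pivots G))
      where
      tried : ∀ x {X : Set ℓ} {b} → Reflects X b →
        Reflects (X ⊎ Accepted (proj₁ x)) (try G n<M member consult d (allowance k) few x b)
      tried (W , _) r = reflects-map Sum.swap Sum.swap
        ((<ᵇ-reflects-< ∣ ∁ W ∣ (allowance k) ×-reflects correct W) ⊎-reflects r)
      sound : ⊥ ⊎ Any Hit (pivots G) → VertexDeletion Π (G , k)
      sound (inj₂ hits) with R , hit ← Any.satisfied hits
        with (W , _) , small , W∈Π ← Any.satisfied hit =
        ∁ W , <allowance⁻ k small , subst (λ V → induced G V ∈ Π) (sym (∁-involutive W)) W∈Π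
      complete : VertexDeletion Π (G , k) → ⊥ ⊎ Any Hit (pivots G)
      complete (S , small , W∈Π)
        with R , R∈ , W⊆ , c≤d ← pivot G d (∁ S) (dense (induced G (∁ S)) W∈Π)
        with b , _ , W∈ ← ∈-candidates d (heavy G R) R (∁ S) W⊆ c≤d =
        inj₂ (lose R∈ (lose W∈ (subst (_< allowance k) (cong ∣_∣ (sym (∁-involutive S))) (<allowance⁺ k small) , W∈Π)))

-- Running time

square-cancel-≤ : ∀ m n → m * m ≤ n * n → m ≤ n
square-cancel-≤ m n m²≤n² with m ≤? n
... | yes m≤n = m≤n
... | no  m≰n = contradiction m²≤n² (<⇒≱ (*-mono-< (≰⇒> m≰n) (≰⇒> m≰n)))

-- As h is an integer, h² ≤ 2m gives h ≤ ⌊√(2m)⌋, and all exponents of 2 stay natural numbers.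
integerSqrt : ∀ x → ∃ λ s → s * s ≤ x × (∀ h → h * h ≤ x → h ≤ s)
integerSqrt x = search x λ h h²≤x → ≤-trans (h≤h² h) h²≤x
  where
  h≤h² : ∀ h → h ≤ h * h
  h≤h² zero    = z≤n
  h≤h² (suc h) = m≤m*n (suc h) (suc h)
  search : ∀ s → (∀ h → h * h ≤ x → h ≤ s) → ∃ λ s → s * s ≤ x × (∀ h → h * h ≤ x → h ≤ s)
  search zero    bound = 0 , z≤n , bound
  search (suc s) bound with suc s * suc s ≤? x
  ... | yes s²≤x = suc s , s²≤x , bound
  ... | no  s²≰x = search s λ h h²≤x →
    s≤s⁻¹ (≤∧≢⇒< (bound h h²≤x) λ { refl → s²≰x h²≤x })

few-candidates : ∀ G d R {s} → ∣ heavy G R ∩ R ∣ ≤ s →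
  length (candidates d (heavy G R) R) ≤ 2 ^ s * (2 + order G) ^ d
few-candidates G d R {s} h≤s = begin
  length (candidates d (heavy G R) R)               ≡⟨ length≡potential (candidates d (heavy G R) R) ⟩
  potential 1 (candidates d (heavy G R) R)          ≤⟨ potential-candidates d 1 (heavy G R) R ⟩
  2 ^ ∣ heavy G R ∩ R ∣ * (1 + order G) ^ d         ≤⟨ *-mono-≤ (^-monoʳ-≤ 2 h≤s) (^-monoˡ-≤ d (n≤1+n _)) ⟩
  2 ^ s * (2 + order G) ^ d                         ∎
  where open ≤-Reasoning

^-distribʳ-* : ∀ k m n → (m * n) ^ k ≡ m ^ k * n ^ k
^-distribʳ-* zero    m n = refl
^-distribʳ-* (suc k) m n = trans (cong (m * n *_) (^-distribʳ-* k m n)) ([m*n]*[o*p]≡[m*o]*[n*p] m n (m ^ k) (n ^ k))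

-- Every p/q ≥ √x is at least `s`; in integers, s²q² ≤ xq² ≤ p² gives sq ≤ p.
≤2^√-intro : ∀ {t x b} s → s * s ≤ x → t ≤ 2 ^ s * b → t ≤2^√ x · b
≤2^√-intro {t} {x} {b} s s²≤x t≤ p q _ xq²≤p² = begin
  t ^ q                 ≤⟨ ^-monoˡ-≤ q t≤ ⟩
  (2 ^ s * b) ^ q       ≡⟨ ^-distribʳ-* q (2 ^ s) b ⟩
  (2 ^ s) ^ q * b ^ q   ≡⟨ cong (_* b ^ q) (^-*-assoc 2 s q) ⟩
  2 ^ (s * q) * b ^ q   ≤⟨ *-monoˡ-≤ (b ^ q) (^-monoʳ-≤ 2 sq≤p) ⟩
  2 ^ p * b ^ q         ∎
  where
  open ≤-Reasoning
  interchange : ∀ s q → s * q * (s * q) ≡ s * s * (q * q)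
  interchange = solve-∀
  sq≤p : s * q ≤ p
  sq≤p = square-cancel-≤ (s * q) p (≤-trans (≤-reflexive (interchange s q))
    (≤-trans (*-monoˡ-≤ (q * q) s²≤x) xq²≤p²))

2+n≤3[1⊔n] : ∀ n → 2 + n ≤ 3 * (1 ⊔ n)
2+n≤3[1⊔n] n = +-mono-≤ (m≤m⊔n 1 n) (≤-trans (+-mono-≤ (m≤m⊔n 1 n) (m≤n⊔m 1 n))
  (≤-reflexive (cong (_+_ (1 ⊔ n)) (sym (+-identityʳ (1 ⊔ n))))))

-- The factor 2 absorbs the successor, as 1 ≤ 2^s M^d, and 3^(d+c) is the price of replacing `M` by
-- `N`.
monomial-bound : ∀ w c d s {M N} → M ≤ 3 * N → 1 ≤ M →
  w * (M ^ c * suc (2 ^ s * M ^ d) ^ 1) ≤ 2 ^ s * (w * (2 * 3 ^ (d + c)) * N ^ (d + c))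
monomial-bound w c d s {M} {N} M≤ 1≤M = begin
  w * (M ^ c * suc (2 ^ s * M ^ d) ^ 1)
    ≤⟨ *-monoʳ-≤ w (*-monoʳ-≤ (M ^ c) (≤-trans (≤-reflexive (*-identityʳ _))
         (+-monoˡ-≤ (2 ^ s * M ^ d) (*-mono-≤ (m^n>0 2 s) (m^n>0 M d))))) ⟩
  w * (M ^ c * (2 ^ s * M ^ d + 2 ^ s * M ^ d))
    ≡⟨ arith w (M ^ c) (2 ^ s) (M ^ d) ⟩
  2 ^ s * (w * 2 * (M ^ d * M ^ c))
    ≡⟨ cong (λ x → 2 ^ s * (w * 2 * x)) (^-distribˡ-+-* M d c) ⟨
  2 ^ s * (w * 2 * M ^ (d + c))
    ≤⟨ *-monoʳ-≤ (2 ^ s) (*-monoʳ-≤ (w * 2) (^-monoˡ-≤ (d + c) M≤)) ⟩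
  2 ^ s * (w * 2 * (3 * N) ^ (d + c))
    ≡⟨ cong (λ x → 2 ^ s * (w * 2 * x)) (^-distribʳ-* (d + c) 3 N) ⟩
  2 ^ s * (w * 2 * (3 ^ (d + c) * N ^ (d + c)))
    ≡⟨ cong (2 ^ s *_) (assoc w (3 ^ (d + c)) (N ^ (d + c))) ⟩
  2 ^ s * (w * (2 * 3 ^ (d + c)) * N ^ (d + c)) ∎
  where
  open ≤-Reasoning
  instance
    M≢0 : NonZero M
    M≢0 = >-nonZero 1≤M
  arith : ∀ w x y z → w * (x * (y * z + y * z)) ≡ y * (w * 2 * (z * x))
  arith = solve-∀
  assoc : ∀ w x y → w * 2 * (x * y) ≡ w * (2 * x) * y
  assoc = solve-∀

theorem12 : ∀ {ℓ} (a : ℕ) → Σ ℕ λ c →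
    ∀ (Π : GraphProperty ℓ) (d : ℕ) →
    (∀ G → G ∈ Π → MinDegreeAtLeast G (order G ∸ d)) →
    (Σ ℕ λ A → DecidableInTime encodeGraph Π (λ G t → t ≤ A * (1 ⊔ order G) ^ a)) →
    Σ ℕ λ C → DecidableInTime encodeInstance (VertexDeletion Π)
    (λ (G , k) t → t ≤2^√ (2 * size G) · (C * (1 ⊔ order G) ^ (d + c)))
theorem12 a = c , λ Π d dense (A , decider , decides) →
  let open Program decider
      w = weight (Cost.poly extra A a (solve d))
      program : Program
      program = record { extra = suc extra ; body = Machine.compile body A a (solve d) }
  in  w * (2 * 3 ^ (d + c)) , program , λ (G , k) →
    -- There are n + 1 pivots, and loops require lengths strictly below the limit. The successor in
    -- `B` serves the same purpose.
    let M = 2 + order G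
        s , s²≤2m , s-max = integerSqrt (2 * size G)
        B = suc (2 ^ s * M ^ d)
        open Machine body A a using (module Run)
        open Run M B using (run; ⇒-oracle)
        member : Subset (order G) → Bool
        member W = proj₁ (decides (induced G W))
        consult = λ W →
          let _ , t , outputs , _ , t≤ = decides (induced G W)
          in  ⇒-oracle outputs (≤-trans t≤ (*-monoʳ-≤ A (^-monoˡ-≤ a
                (⊔-lub (s≤s z≤n) (m≤n⇒m≤o+n 2 (Subset.∣p∣≤n W))))))
        correct = λ W → proj₁ (proj₂ (proj₂ (proj₂ (decides (induced G W)))))
        few = λ R → s≤s (few-candidates G d R (s-max _ (∣heavy∩R∣²≤2m G R)))
        js , t , t≤ , halts = run (⇒-solve body A a M B Π d dense G ≤-refl member consult correct few k) nil _
    in  answer body A a M B Π d dense G ≤-refl member consult correct few k , t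
      , (nil ∷ js , halts)
      , answer-reflects body A a M B Π d dense G ≤-refl member consult correct few k
      , ≤2^√-intro s s²≤2m (begin
          t ≤⟨ t≤ ⟩
          at (Cost.poly extra A a (solve d)) M B ≤⟨ at≤monomial (Cost.poly extra A a (solve d)) M B ⟩
          -- The exponent of `B` is `degreeLong` of the program, which evaluates to 1 because loops
          -- over candidates are never nested.
          w * (M ^ c * B ^ 1) ≤⟨ monomial-bound w c d s (2+n≤3[1⊔n] (order G)) (s≤s z≤n) ⟩
          2 ^ s * (w * (2 * 3 ^ (d + c)) * (1 ⊔ order G) ^ (d + c)) ∎)
  where
  open ≤-Reasoning
  -- The oracle's registers, A and d enter the time bound only as coefficients,
  -- so its degree can be read off with all of them set to 0.
  c : ℕ
  c = degreeShort (Cost.poly 0 0 a (solve 0))
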